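{- Let $n$, $l$, and $t$ be non-negative integers such that $t\leq n$. Then $$\sum_{k=t}^{2n-t}(-1)^k\binom{2n-2t}{k-t}S(k,l)\,S(2n-k,l)=(-1)^t\,\frac{\binom{2l}{l}\binom{2t}{t}\binom{2(n+l-t)}{n+l-t}\binom{2n}{n}\binom{2n-2t}{n-t}}{\binom{n+l}{n}\binom{2n+l-t}{n}\binom{n}{t}}.$$
   Context: For non-negative integers $a$ and $b$, the super Catalan number is $S(a,b)=\dfrac{\binom{2a}{a}\binom{2b}{b}}{\binom{a+b}{a}}=\dfrac{(2a)!\,(2b)!}{a!\,b!\,(a+b)!}$; it is always an integer. -}

module Defs where

open import Data.Integer.Base using (+_)
open import Data.List.Base using (applyUpTo; foldr)
open import Data.Nat.Base using (ℕ; suc; _+_; _*_; _∸_; _≤_; _!; NonZero; >-nonZero)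
open import Data.Nat.Combinatorics using (_C_; k![n∸k]!∣n!)
open import Data.Nat.Combinatorics.Specification using (nCk≡n!/k![n-k]!)
open import Data.Nat.Divisibility using (∣⇒≤)
open import Data.Nat.DivMod using (m≥n⇒m/n>0)
open import Data.Nat.Properties using (_!≢0; _!*_!≢0; m*n≢0; m≤m+n; +-identityʳ; +-assoc; +-∸-assoc; ≤-trans)
open import Data.Rational.Base as ℚ using (ℚ; 0ℚ; _/_)
open import Relation.Binary.PropositionalEquality using (sym; subst)

nCk≢0 : ∀ {n k} → k ≤ n → NonZero (n C k)
nCk≢0 {n} {k} k≤n = subst NonZero (sym (nCk≡n!/k![n-k]! k≤n))
  (>-nonZero (m≥n⇒m/n>0 {{_}} (∣⇒≤ (k![n∸k]!∣n! k≤n))))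
  where instance
    _ = n !≢0
    _ = k !* (n ∸ k) !≢0

-- Rational-valued, so that the defining quotient is an exact division.
S : ℕ → ℕ → ℚ
S a b = (+ (((2 * a) C a) * ((2 * b) C b))) / ((a + b) C a)
  where instance
    _ = nCk≢0 (m≤m+n a b)

n≤2n+l∸t : ∀ {n t} l → t ≤ n → n ≤ 2 * n + l ∸ t
n≤2n+l∸t {n} {t} l t≤n
  rewrite +-identityʳ n | +-assoc n n l | +-∸-assoc n (≤-trans t≤n (m≤m+n n l))
  = m≤m+n n (n + l ∸ t)

denominator≢0 : ∀ n l t → t ≤ n →
  NonZero (((n + l) C n) * ((2 * n + l ∸ t) C n) * (n C t))
denominator≢0 n l t t≤n = m*n≢0 (((n + l) C n) * ((2 * n + l ∸ t) C n)) (n C t)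
  where instance
    i₁ = nCk≢0 (m≤m+n n l)
    i₂ = nCk≢0 (n≤2n+l∸t l t≤n)
    i₃ = nCk≢0 t≤n
    i₄ = m*n≢0 ((n + l) C n) ((2 * n + l ∸ t) C n)

-- Both endpoints are included; the sum is empty when b < a.
sumFromTo : ℕ → ℕ → (ℕ → ℚ) → ℚ
sumFromTo a b f = foldr ℚ._+_ 0ℚ (applyUpTo (λ i → f (a + i)) (suc b ∸ a))

infix 5 sumFromTo
syntax sumFromTo a b (λ k → e) = ∑[ k from a to b ] e

{-# OPTIONS --safe #-}
module Submission where

-- For fixed l, S(a,l) is, up to a constant factor, the a-th moment of the Beta-type
-- weight x^(-1/2) (4 - x)^(l - 1/2) on [0,4].  With n = m + t, the sum is therefore, up to
-- the sign (-1)^t, the two-variable Selberg-type integral of (xy)^t (x - y)^(2m).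
-- Only the moments are needed: the recurrence (l+1+a) S(a+1,l) = (2+4a) S(a,l) is
-- integration by parts for the weight.  Following Aomoto, integrating by parts
-- against (xy)^t (x - y)^(2m) times 1, x and y, and exploiting the symmetry x <-> y,
-- gives a first-order recurrence in m, which is solved by a quotient of factorials.

open import Defs

module SuperCatalanSum where

  import Data.Integer.Base as ℤ
  open import Data.Integer.Base using (ℤ; -1ℤ)
  import Data.Integer.Properties as ℤ
  open import Data.List.Base using (applyUpTo; foldr)
  open import Data.Nat.Base as ℕ using (ℕ; zero; suc; _!; _∸_; _≤_; _<_; z≤n; s≤s; NonZero)
  open import Data.Nat.Combinatorics
    using (_C_; nCn≡1; nCk≡nC[n∸k]; nCk+nC[k+1]≡[n+1]C[k+1]; k![n∸k]!∣n!)
  open import Data.Nat.Combinatorics.Specification using (nCk≡n!/k![n-k]!; k>n⇒nCk≡0)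
  open import Data.Nat.DivMod using (m/n*n≡m)
  import Data.Nat.Properties as ℕ
  open import Data.Nat.Solver using () renaming (module +-*-Solver to ℕ-Solver)
  open import Data.Rational.Base using (ℚ; 0ℚ; 1ℚ; ½; _/_; _+_; _*_; _-_; -_)
  open import Data.Rational.Properties
  open import Data.Rational.Solver using (module +-*-Solver)
  open import Data.Rational.Unnormalised.Base using (mkℚᵘ; *≡*)
  import Data.Rational.Unnormalised.Properties as ℚᵘ
  open import Relation.Binary.PropositionalEquality
    using (_≡_; refl; sym; trans; cong; cong₂; subst; module ≡-Reasoning)
  open +-*-Solver using (solve; con; _:=_; _:+_; _:*_; _:-_; :-_)
  open ℕ-Solver using ()
    renaming (solve to solveℕ; _:=_ to _:≡_; _:*_ to _⊛_; _:+_ to _⊕_; con to κ)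
  open ≡-Reasoning

  -- Aomoto's recurrence for an abstract moment sequence.

  double-cancel : ∀ {p q} → p + p ≡ q + q → p ≡ q
  double-cancel {p} {q} eq = trans (half p) (trans (cong (½ *_) eq) (sym (half q)))
    where
    half : ∀ x → x ≡ ½ * (x + x)
    half = solve 1 (λ x → x := con ½ :* (x :+ x)) refl

  x≡-x⇒x≡0 : ∀ {p} → p ≡ - p → p ≡ 0ℚ
  x≡-x⇒x≡0 {p} eq = double-cancel (trans (cong (p +_) eq) (+-inverseʳ p))

  -- The recurrence `u-suc` is all that is assumed of the weight. The super Catalan numbers S(a,l)
  -- fit with c = l + 1, d = 2, e = 4 and `ι` the embedding of the naturals.
  module Moments
    (u ι : ℕ → ℚ) (c d e : ℚ)
    (ι-zero : ι 0 ≡ 0ℚ)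
    (ι-suc : ∀ n → ι (suc n) ≡ 1ℚ + ι n)
    (u-suc : ∀ a → (c + ι a) * u (suc a) ≡ (d + e * ι a) * u a)
    where

    -- With 𝔼 the linear functional on polynomials such that 𝔼[x^a y^b] = u a * u b,
    -- T N a b = 𝔼[x^a y^b (x - y)^N] and D N a b = 𝔼[x^a y^b ∂ₓ((x - y)^N)].
    T : ℕ → ℕ → ℕ → ℚ
    T zero    a b = u a * u b
    T (suc N) a b = T N (suc a) b - T N a (suc b)

    D : ℕ → ℕ → ℕ → ℚ
    D zero    a b = 0ℚ
    D (suc N) a b = D N (suc a) b - D N a (suc b) + T N a b

    sign : ℕ → ℚ
    sign zero    = 1ℚ
    sign (suc N) = - sign N

    T-swap : ∀ N a b → T N b a ≡ sign N * T N a b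
    T-swap zero a b = trans (*-comm (u b) (u a)) (sym (*-identityˡ _))
    T-swap (suc N) a b = trans (cong₂ _-_ (T-swap N a (suc b)) (T-swap N (suc a) b))
      (solve 3 (λ s x y → s :* x :- s :* y := (:- s) :* (y :- x)) refl
        (sign N) (T N a (suc b)) (T N (suc a) b))

    -- The derivative of (x - y)^N is a multiple of (x - y)^(N-1), so exchanging the variables
    -- produces the sign opposite to that in `T-swap`.
    D-swap : ∀ N a b → D N b a ≡ - sign N * D N a b
    D-swap zero a b = refl
    D-swap (suc N) a b = trans
      (cong₂ _+_ (cong₂ _-_ (D-swap N a (suc b)) (D-swap N (suc a) b)) (T-swap N a b))
      (solve 4 (λ s x y z → (:- s) :* x :- (:- s) :* y :+ s :* z
                         := (:- (:- s)) :* (y :- x :+ z)) refl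
        (sign N) (D N a (suc b)) (D N (suc a) b) (T N a b))

    -- Euler's identity for the homogeneous polynomial (x - y)^N.
    euler : ∀ N a b → D N (suc a) b - D N a (suc b) ≡ ι N * T N a b
    euler zero a b = sym (trans (cong (_* T 0 a b) ι-zero) (*-zeroˡ (T 0 a b)))
    euler (suc N) a b = begin
      (D N (2+ a) b - D N (suc a) (suc b) + T N (suc a) b)
        - (D N (suc a) (suc b) - D N a (2+ b) + T N a (suc b))
        ≡⟨ solve 5 (λ p q r x y → (p :- q :+ x) :- (q :- r :+ y)
                               := (x :- y) :+ ((p :- q) :- (q :- r))) refl
             (D N (2+ a) b) (D N (suc a) (suc b)) (D N a (2+ b)) (T N (suc a) b) (T N a (suc b)) ⟩
      T (suc N) a b + ((D N (2+ a) b - D N (suc a) (suc b)) - (D N (suc a) (suc b) - D N a (2+ b)))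
        ≡⟨ cong (T (suc N) a b +_) (cong₂ _-_ (euler N (suc a) b) (euler N a (suc b))) ⟩
      T (suc N) a b + (ι N * T N (suc a) b - ι N * T N a (suc b))
        ≡⟨ solve 3 (λ n x y → (x :- y) :+ (n :* x :- n :* y) := (con 1ℚ :+ n) :* (x :- y)) refl
             (ι N) (T N (suc a) b) (T N a (suc b)) ⟩
      (1ℚ + ι N) * T (suc N) a b
        ≡⟨ cong (_* T (suc N) a b) (ι-suc N) ⟨
      ι (suc N) * T (suc N) a b ∎
      where
      2+ : ℕ → ℕ
      2+ n = suc (suc n)

    -- u-suc says 𝔼[(c x - d) p + x (x - e) ∂ₓp] = 0 for p = x^a; here p = x^a y^b (x - y)^N.
    by-parts : ∀ N a b →
      (c + ι a) * T N (suc a) b + (D N (suc (suc a)) b - e * D N (suc a) b)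
        ≡ (d + e * ι a) * T N a b
    by-parts zero a b = begin
      (c + ι a) * (u (suc a) * u b) + (0ℚ - e * 0ℚ)
        ≡⟨ solve 4 (λ k x y e → k :* (x :* y) :+ (con 0ℚ :- e :* con 0ℚ) := (k :* x) :* y) refl
             (c + ι a) (u (suc a)) (u b) e ⟩
      ((c + ι a) * u (suc a)) * u b  ≡⟨ cong (_* u b) (u-suc a) ⟩
      ((d + e * ι a) * u a) * u b    ≡⟨ *-assoc (d + e * ι a) (u a) (u b) ⟩
      (d + e * ι a) * (u a * u b)    ∎
    by-parts (suc N) a b = begin
      -- Splitting the factor x - y gives the identity at `(suc a, b)` minus the one at
      -- `(a, suc b)`. The product-rule term `x₂` turns `c + ι a` into `c + ι (suc a)`, and the
      -- other one, `e * x₁`, is absorbed on the right-hand side.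
      (c + ι a) * (x₂ - y₁) + ((p₃ - q₂ + x₂) - e * (p₂ - q₁ + x₁))
        ≡⟨ solve 10 (λ c i e x₂ y₁ x₁ p₃ q₂ p₂ q₁ →
             (c :+ i) :* (x₂ :- y₁) :+ ((p₃ :- q₂ :+ x₂) :- e :* (p₂ :- q₁ :+ x₁))
             := ((c :+ (con 1ℚ :+ i)) :* x₂ :+ (p₃ :- e :* p₂))
                :- ((c :+ i) :* y₁ :+ (q₂ :- e :* q₁)) :- e :* x₁) refl
             c (ι a) e x₂ y₁ x₁ p₃ q₂ p₂ q₁ ⟩
      ((c + (1ℚ + ι a)) * x₂ + (p₃ - e * p₂)) - ((c + ι a) * y₁ + (q₂ - e * q₁)) - e * x₁
        ≡⟨ cong (λ z → ((c + z) * x₂ + (p₃ - e * p₂)) - ((c + ι a) * y₁ + (q₂ - e * q₁)) - e * x₁)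
             (ι-suc a) ⟨
      ((c + ι (suc a)) * x₂ + (p₃ - e * p₂)) - ((c + ι a) * y₁ + (q₂ - e * q₁)) - e * x₁
        ≡⟨ cong₂ (λ z w → z - w - e * x₁) (by-parts N (suc a) b) (by-parts N a (suc b)) ⟩
      (d + e * ι (suc a)) * x₁ - (d + e * ι a) * y₀ - e * x₁
        ≡⟨ cong (λ z → (d + e * z) * x₁ - (d + e * ι a) * y₀ - e * x₁) (ι-suc a) ⟩
      (d + e * (1ℚ + ι a)) * x₁ - (d + e * ι a) * y₀ - e * x₁
        ≡⟨ solve 5 (λ d e i x₁ y₀ →
             (d :+ e :* (con 1ℚ :+ i)) :* x₁ :- (d :+ e :* i) :* y₀ :- e :* x₁
             := (d :+ e :* i) :* (x₁ :- y₀)) refl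
             d e (ι a) x₁ y₀ ⟩
      (d + e * ι a) * (x₁ - y₀) ∎
      where
      x₁ = T N (suc a) b
      x₂ = T N (suc (suc a)) b
      y₀ = T N a (suc b)
      y₁ = T N (suc a) (suc b)
      p₂ = D N (suc (suc a)) b
      p₃ = D N (suc (suc (suc a))) b
      q₁ = D N (suc a) (suc b)
      q₂ = D N (suc (suc a)) (suc b)

    -- For even N = 2μ the moments `T` are symmetric and the `D` antisymmetric in the exponents.
    -- Together with Euler's identity this expresses every `D` near the diagonal through `T`.
    module Even (N : ℕ) (sign≡1 : sign N ≡ 1ℚ) (μ : ℚ) (ιN≡2μ : ι N ≡ μ + μ) (t : ℕ) where

      T-sym : ∀ a b → T N b a ≡ T N a b
      T-sym a b = trans (T-swap N a b) (trans (cong (_* T N a b) sign≡1) (*-identityˡ _))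

      D-antisym : ∀ a b → D N b a ≡ - D N a b
      D-antisym a b = trans (D-swap N a b) (trans (cong (λ s → - s * D N a b) sign≡1)
        (solve 1 (λ x → (:- con 1ℚ) :* x := :- x) refl (D N a b)))

      D-diagonal : ∀ a → D N a a ≡ 0ℚ
      D-diagonal a = x≡-x⇒x≡0 (D-antisym a a)

      euler′ : ∀ a b → D N (suc a) b - D N a (suc b) ≡ (μ + μ) * T N a b
      euler′ a b = trans (euler N a b) (cong (_* T N a b) ιN≡2μ)

      -- By antisymmetry the left side of Euler's identity on the diagonal is twice this value.
      D₁ : ∀ a → D N (suc a) a ≡ μ * T N a a
      D₁ a = double-cancel (begin
        D N (suc a) a + D N (suc a) a
          ≡⟨ cong (D N (suc a) a +_) (D-antisym a (suc a)) ⟩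
        D N (suc a) a - D N a (suc a)
          ≡⟨ euler′ a a ⟩
        (μ + μ) * T N a a
          ≡⟨ *-distribʳ-+ (T N a a) μ μ ⟩
        μ * T N a a + μ * T N a a ∎)

      D₂ : ∀ a → D N (suc (suc a)) a ≡ (μ + μ) * T N (suc a) a
      D₂ a = begin
        D N (suc (suc a)) a
          ≡⟨ +-identityʳ _ ⟨
        D N (suc (suc a)) a - 0ℚ
          ≡⟨ cong (λ z → D N (suc (suc a)) a - z) (D-diagonal (suc a)) ⟨
        D N (suc (suc a)) a - D N (suc a) (suc a)
          ≡⟨ euler′ (suc a) a ⟩
        (μ + μ) * T N (suc a) a ∎

      D₃ : ∀ a → D N (suc (suc (suc a))) a
               ≡ (μ + μ) * T N (suc (suc a)) a + μ * T N (suc a) (suc a)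
      D₃ a = begin
        D N (suc (suc (suc a))) a
          ≡⟨ solve 2 (λ x y → x := (x :- y) :+ y) refl (D N (suc (suc (suc a))) a) (D N (suc (suc a)) (suc a)) ⟩
        (D N (suc (suc (suc a))) a - D N (suc (suc a)) (suc a)) + D N (suc (suc a)) (suc a)
          ≡⟨ cong₂ _+_ (euler′ (suc (suc a)) a) (D₁ (suc a)) ⟩
        (μ + μ) * T N (suc (suc a)) a + μ * T N (suc a) (suc a) ∎

      β δ F A B X : ℚ
      β = c + ι t
      δ = d + e * ι t
      F = T N t t
      A = T N (suc t) t
      B = T N (suc (suc t)) t
      X = T N (suc t) (suc t)

      -- Integration by parts against (xy)^t (x - y)^N itself; `D₂` and `D₁` remove the derivatives.
      A-relation : (β + (μ + μ)) * A ≡ (δ + e * μ) * F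
      A-relation = begin
        (β + (μ + μ)) * A
          ≡⟨ solve 5 (λ β μ e A F → (β :+ (μ :+ μ)) :* A
               := (β :* A :+ ((μ :+ μ) :* A :- e :* (μ :* F))) :+ e :* μ :* F) refl β μ e A F ⟩
        (β * A + ((μ + μ) * A - e * (μ * F))) + e * μ * F
          ≡⟨ cong₂ (λ z w → (β * A + (z - e * w)) + e * μ * F) (D₂ t) (D₁ t) ⟨
        (β * A + (D N (suc (suc t)) t - e * D N (suc t) t)) + e * μ * F
          ≡⟨ cong (_+ e * μ * F) (by-parts N t t) ⟩
        δ * F + e * μ * F
          ≡⟨ *-distribʳ-+ F δ (e * μ) ⟨
        (δ + e * μ) * F ∎

      -- Integration by parts with the extra factor y; one of the two derivative terms lies on the
      -- diagonal and vanishes.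
      X-relation : (β + μ) * X ≡ δ * A
      X-relation = begin
        (β + μ) * X
          ≡⟨ solve 4 (λ β μ e X → (β :+ μ) :* X
               := β :* X :+ (μ :* X :- e :* con 0ℚ)) refl β μ e X ⟩
        β * X + (μ * X - e * 0ℚ)
          ≡⟨ cong₂ (λ z w → β * X + (z - e * w)) (D₁ (suc t)) (D-diagonal (suc t)) ⟨
        β * X + (D N (suc (suc t)) (suc t) - e * D N (suc t) (suc t))
          ≡⟨ by-parts N t (suc t) ⟩
        δ * T N t (suc t)
          ≡⟨ cong (δ *_) (T-sym (suc t) t) ⟩
        δ * A ∎

      -- Integration by parts with the extra factor x; the term in `X` enters through `D₃`.
      B-relation : (β + (μ + μ) + 1ℚ) * B ≡ (δ + e * (1ℚ + (μ + μ))) * A - μ * X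
      B-relation = begin
        (β + (μ + μ) + 1ℚ) * B
          ≡⟨ solve 7 (λ c i μ e A B X → (c :+ i :+ (μ :+ μ) :+ con 1ℚ) :* B
               := ((c :+ (con 1ℚ :+ i)) :* B :+ (((μ :+ μ) :* B :+ μ :* X) :- e :* ((μ :+ μ) :* A)))
                 :+ (e :* (μ :+ μ) :* A :- μ :* X)) refl c (ι t) μ e A B X ⟩
        ((c + (1ℚ + ι t)) * B + (((μ + μ) * B + μ * X) - e * ((μ + μ) * A))) + r
          ≡⟨ cong (λ z → ((c + z) * B + (((μ + μ) * B + μ * X) - e * ((μ + μ) * A))) + r) (ι-suc t) ⟨
        ((c + ι (suc t)) * B + (((μ + μ) * B + μ * X) - e * ((μ + μ) * A))) + r
          ≡⟨ cong₂ (λ z w → ((c + ι (suc t)) * B + (z - e * w)) + r) (D₃ t) (D₂ t) ⟨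
        ((c + ι (suc t)) * B + (D N (suc (suc (suc t))) t - e * D N (suc (suc t)) t)) + r
          ≡⟨ cong (_+ r) (by-parts N (suc t) t) ⟩
        (d + e * ι (suc t)) * A + r
          ≡⟨ cong (λ z → (d + e * z) * A + r) (ι-suc t) ⟩
        (d + e * (1ℚ + ι t)) * A + r
          ≡⟨ solve 6 (λ d i e μ A X → (d :+ e :* (con 1ℚ :+ i)) :* A :+ (e :* (μ :+ μ) :* A :- μ :* X)
               := (d :+ e :* i :+ e :* (con 1ℚ :+ (μ :+ μ))) :* A :- μ :* X) refl d (ι t) e μ A X ⟩
        (δ + e * (1ℚ + (μ + μ))) * A - μ * X ∎
        where r = e * (μ + μ) * A - μ * X

      T-2+N : T (suc (suc N)) t t ≡ (B - X) + (B - X)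
      T-2+N = trans (cong (λ z → (B - X) - (X - z)) (T-sym (suc (suc t)) t))
        (solve 2 (λ B X → (B :- X) :- (X :- B) := (B :- X) :+ (B :- X)) refl B X)

      -- Since (x - y)^2 = x^2 - 2xy + y^2, the new moment is 2(B - X), and the three relations
      -- reduce it to `F`. The factor on the left is the product of their leading coefficients, so
      -- nothing is divided.
      step : T (suc (suc N)) t t * ((β + μ) * (β + (μ + μ)) * (β + (μ + μ) + 1ℚ))
           ≡ T N t t * ((1ℚ + 1ℚ) * ((μ + μ) + 1ℚ) * (δ + e * μ) * (e * β - δ + e * μ))
      step = begin
        T (suc (suc N)) t t * ((β + μ) * (β + (μ + μ)) * k)
          ≡⟨ cong (_* ((β + μ) * (β + (μ + μ)) * k)) T-2+N ⟩
        ((B - X) + (B - X)) * ((β + μ) * (β + (μ + μ)) * k)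
          -- `B` and `X` are each paired with their own leading coefficient; `β + (μ + μ)` stays
          -- outside until only `A` is left.
          ≡⟨ solve 5 (λ B X p q k → ((B :- X) :+ (B :- X)) :* (p :* q :* k)
               := (con 1ℚ :+ con 1ℚ) :* q :* (p :* (k :* B) :- k :* (p :* X)))
               refl B X (β + μ) (β + (μ + μ)) k ⟩
        (1ℚ + 1ℚ) * (β + (μ + μ)) * ((β + μ) * (k * B) - k * ((β + μ) * X))
          ≡⟨ cong₂ (λ z w → (1ℚ + 1ℚ) * (β + (μ + μ)) * ((β + μ) * z - k * w)) B-relation X-relation ⟩
        (1ℚ + 1ℚ) * (β + (μ + μ)) * ((β + μ) * (h * A - μ * X) - k * (δ * A))
          ≡⟨ solve 8 (λ A X p q k h μ δ → (con 1ℚ :+ con 1ℚ) :* q :* (p :* (h :* A :- μ :* X) :- k :* (δ :* A))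
               := (con 1ℚ :+ con 1ℚ) :* q :* ((p :* h :- k :* δ) :* A :- μ :* (p :* X)))
               refl A X (β + μ) (β + (μ + μ)) k h μ δ ⟩
        (1ℚ + 1ℚ) * (β + (μ + μ)) * (((β + μ) * h - k * δ) * A - μ * ((β + μ) * X))
          ≡⟨ cong (λ z → (1ℚ + 1ℚ) * (β + (μ + μ)) * (((β + μ) * h - k * δ) * A - μ * z)) X-relation ⟩
        (1ℚ + 1ℚ) * (β + (μ + μ)) * (((β + μ) * h - k * δ) * A - μ * (δ * A))
          -- The coefficient of `A` factors as (2μ + 1)(eβ - δ + eμ), which is why the recurrence
          -- has a product solution.
          ≡⟨ solve 5 (λ A β μ δ e →
               (con 1ℚ :+ con 1ℚ) :* (β :+ (μ :+ μ))
                 :* (((β :+ μ) :* (δ :+ e :* (con 1ℚ :+ (μ :+ μ)))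
                       :- (β :+ (μ :+ μ) :+ con 1ℚ) :* δ) :* A :- μ :* (δ :* A))
               := ((β :+ (μ :+ μ)) :* A)
                 :* ((con 1ℚ :+ con 1ℚ) :* ((μ :+ μ) :+ con 1ℚ) :* (e :* β :- δ :+ e :* μ)))
               refl A β μ δ e ⟩
        ((β + (μ + μ)) * A) * ((1ℚ + 1ℚ) * ((μ + μ) + 1ℚ) * (e * β - δ + e * μ))
          ≡⟨ cong (_* ((1ℚ + 1ℚ) * ((μ + μ) + 1ℚ) * (e * β - δ + e * μ))) A-relation ⟩
        ((δ + e * μ) * F) * ((1ℚ + 1ℚ) * ((μ + μ) + 1ℚ) * (e * β - δ + e * μ))
          ≡⟨ solve 4 (λ F p q r → (p :* F) :* (q :* r) := F :* (q :* p :* r)) refl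
               F (δ + e * μ) ((1ℚ + 1ℚ) * ((μ + μ) + 1ℚ)) (e * β - δ + e * μ) ⟩
        F * ((1ℚ + 1ℚ) * ((μ + μ) + 1ℚ) * (δ + e * μ) * (e * β - δ + e * μ)) ∎
        where
        k = β + (μ + μ) + 1ℚ
        h = δ + e * (1ℚ + (μ + μ))

  -- Embedding the integers in the rationals and clearing denominators.

  fromℤ : ℤ → ℚ
  fromℤ z = z / 1

  fromℕ : ℕ → ℚ
  fromℕ n = fromℤ (ℤ.+ n)

  -- `_/_` divides by a gcd and does not reduce on variables, so the equation is checked among
  -- unnormalised fractions, where denominators 1 multiply by computation.
  fromℤ-* : ∀ y z → fromℤ (y ℤ.* z) ≡ fromℤ y * fromℤ z
  fromℤ-* y z = toℚᵘ-injective (ℚᵘ.≃-trans (toℚᵘ-fromℚᵘ (mkℚᵘ (y ℤ.* z) 0)) (ℚᵘ.≃-sym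
    (ℚᵘ.≃-trans (toℚᵘ-homo-* (fromℤ y) (fromℤ z))
      (ℚᵘ.*-cong (toℚᵘ-fromℚᵘ (mkℚᵘ y 0)) (toℚᵘ-fromℚᵘ (mkℚᵘ z 0))))))

  fromℤ-+ : ∀ y z → fromℤ (y ℤ.+ z) ≡ fromℤ y + fromℤ z
  fromℤ-+ y z = toℚᵘ-injective (ℚᵘ.≃-trans (toℚᵘ-fromℚᵘ (mkℚᵘ (y ℤ.+ z) 0)) (ℚᵘ.≃-sym
    (ℚᵘ.≃-trans (toℚᵘ-homo-+ (fromℤ y) (fromℤ z))
      (ℚᵘ.≃-trans (ℚᵘ.+-cong (toℚᵘ-fromℚᵘ (mkℚᵘ y 0)) (toℚᵘ-fromℚᵘ (mkℚᵘ z 0)))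
        (ℚᵘ.≃-reflexive (cong₂ (λ v w → mkℚᵘ (v ℤ.+ w) 0) (ℤ.*-identityʳ y) (ℤ.*-identityʳ z)))))))

  fromℕ-+ : ∀ m n → fromℕ (m ℕ.+ n) ≡ fromℕ m + fromℕ n
  fromℕ-+ m n = fromℤ-+ (ℤ.+ m) (ℤ.+ n)

  fromℕ-* : ∀ m n → fromℕ (m ℕ.* n) ≡ fromℕ m * fromℕ n
  fromℕ-* m n = trans (cong fromℤ (ℤ.pos-* m n)) (fromℤ-* (ℤ.+ m) (ℤ.+ n))

  /-*-cancel : ∀ z d .{{_ : NonZero d}} → (z / d) * fromℕ d ≡ fromℤ z
  /-*-cancel z (suc d) = toℚᵘ-injective
    (ℚᵘ.≃-trans (toℚᵘ-homo-* (z / suc d) (fromℕ (suc d)))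
    (ℚᵘ.≃-trans (ℚᵘ.*-cong (toℚᵘ-fromℚᵘ (mkℚᵘ z d)) (toℚᵘ-fromℚᵘ (mkℚᵘ (ℤ.+ suc d) 0)))
    (ℚᵘ.≃-trans (*≡* (ℤ.*-assoc z (ℤ.+ suc d) (ℤ.+ 1)))
    (ℚᵘ.≃-sym (toℚᵘ-fromℚᵘ (mkℚᵘ z 0))))))

  *-cancelʳ-fromℕ : ∀ d .{{_ : NonZero d}} {p q} → p * fromℕ d ≡ q * fromℕ d → p ≡ q
  *-cancelʳ-fromℕ d {p} {q} eq = trans (sym (undo p)) (trans (cong (_* r) eq) (undo q))
    where
    r = ℤ.+ 1 / d
    undo : ∀ x → x * fromℕ d * r ≡ x
    undo x = begin
      x * fromℕ d * r    ≡⟨ *-assoc x (fromℕ d) r ⟩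
      x * (fromℕ d * r)  ≡⟨ cong (x *_) (*-comm (fromℕ d) r) ⟩
      x * (r * fromℕ d)  ≡⟨ cong (x *_) (/-*-cancel (ℤ.+ 1) d) ⟩
      x * 1ℚ             ≡⟨ *-identityʳ x ⟩
      x                  ∎

  ≡-/ : ∀ {p} z d .{{_ : NonZero d}} → p * fromℕ d ≡ fromℤ z → p ≡ z / d
  ≡-/ z d eq = *-cancelʳ-fromℕ d (trans eq (sym (/-*-cancel z d)))

  -- Binomial coefficients through factorials.

  [a+b]Ca*a!*b! : ∀ a b → ((a ℕ.+ b) C a) ℕ.* (a ! ℕ.* b !) ≡ (a ℕ.+ b) !
  [a+b]Ca*a!*b! a b = begin
    ((a ℕ.+ b) C a) ℕ.* (a ! ℕ.* b !)
      ≡⟨ cong (λ x → ((a ℕ.+ b) C a) ℕ.* (a ! ℕ.* x !)) (ℕ.m+n∸m≡n a b) ⟨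
    ((a ℕ.+ b) C a) ℕ.* (a ! ℕ.* (a ℕ.+ b ∸ a) !)
      ≡⟨ cong (ℕ._* (a ! ℕ.* (a ℕ.+ b ∸ a) !)) (nCk≡n!/k![n-k]! a≤a+b) ⟩
    _ ≡⟨ m/n*n≡m {{_}} (k![n∸k]!∣n! a≤a+b) ⟩
    (a ℕ.+ b) ! ∎
    where
    a≤a+b = ℕ.m≤m+n a b

  central : ∀ a → ((2 ℕ.* a) C a) ℕ.* (a ! ℕ.* a !) ≡ (2 ℕ.* a) !
  central a = subst (λ n → (n C a) ℕ.* (a ! ℕ.* a !) ≡ n !)
    (cong (a ℕ.+_) (sym (ℕ.+-identityʳ a))) ([a+b]Ca*a!*b! a a)

  nC0≡1 : ∀ n → n C 0 ≡ 1
  nC0≡1 n = trans (nCk≡nC[n∸k] {k = 0} {n = n} z≤n) (nCn≡1 n)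

  -- Finite sums and the binomial expansion.

  -- The form to which `sumFromTo` unfolds.
  sum : (ℕ → ℚ) → ℕ → ℚ
  sum f n = foldr _+_ 0ℚ (applyUpTo f n)

  -- The bound `i < n` is passed on because identities such as `suc n ∸ i ≡ suc (n ∸ i)` hold only
  -- within the range of summation.
  sum-cong : ∀ {f g} n → (∀ i → i < n → f i ≡ g i) → sum f n ≡ sum g n
  sum-cong zero    f≗g = refl
  sum-cong (suc n) f≗g = cong₂ _+_ (f≗g 0 (s≤s z≤n)) (sum-cong n (λ i i<n → f≗g (suc i) (s≤s i<n)))

  sum-distribˡ : ∀ c f n → sum (λ i → c * f i) n ≡ c * sum f n
  sum-distribˡ c f zero    = sym (*-zeroʳ c)
  sum-distribˡ c f (suc n) = trans (cong (c * f 0 +_) (sum-distribˡ c (λ i → f (suc i)) n))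
    (sym (*-distribˡ-+ c (f 0) (sum (λ i → f (suc i)) n)))

  sum-minus : ∀ f g n → sum (λ i → f i - g i) n ≡ sum f n - sum g n
  sum-minus f g zero    = refl
  sum-minus f g (suc n) = trans (cong (f 0 - g 0 +_) (sum-minus (λ i → f (suc i)) (λ i → g (suc i)) n))
    (solve 4 (λ p q x y → (p :- q) :+ (x :- y) := (p :+ x) :- (q :+ y)) refl
      (f 0) (g 0) (sum (λ i → f (suc i)) n) (sum (λ i → g (suc i)) n))

  sum-last : ∀ f n → sum f (suc n) ≡ sum f n + f n
  sum-last f zero    = +-comm (f 0) 0ℚ
  sum-last f (suc n) = trans (cong (f 0 +_) (sum-last (λ i → f (suc i)) n)) (sym (+-assoc (f 0) _ _))

  coeff : ℕ → ℕ → ℚ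
  coeff n i = fromℤ (-1ℤ ℤ.^ i ℤ.* ℤ.+ (n C i))

  coeff-zero : ∀ n → coeff n 0 ≡ 1ℚ
  coeff-zero n = cong (λ x → fromℤ (ℤ.1ℤ ℤ.* ℤ.+ x)) (nC0≡1 n)

  coeff-suc : ∀ n i → coeff (suc n) (suc i) ≡ coeff n (suc i) - coeff n i
  coeff-suc n i = begin
    fromℤ (σ′ ℤ.* ℤ.+ (suc n C suc i))
      ≡⟨ cong (λ x → fromℤ (σ′ ℤ.* ℤ.+ x)) (nCk+nC[k+1]≡[n+1]C[k+1] n i) ⟨
    fromℤ (σ′ ℤ.* ℤ.+ (n C i ℕ.+ n C suc i))
      ≡⟨ fromℤ-* σ′ (ℤ.+ (n C i ℕ.+ n C suc i)) ⟩
    fromℤ σ′ * fromℕ (n C i ℕ.+ n C suc i)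
      ≡⟨ cong₂ _*_ (fromℤ-* -1ℤ σ) (fromℕ-+ (n C i) (n C suc i)) ⟩
    (- 1ℚ * fromℤ σ) * (fromℕ (n C i) + fromℕ (n C suc i))
      ≡⟨ solve 3 (λ s x y → (:- con 1ℚ :* s) :* (x :+ y) := (:- con 1ℚ :* s) :* y :- s :* x) refl
           (fromℤ σ) (fromℕ (n C i)) (fromℕ (n C suc i)) ⟩
    (- 1ℚ * fromℤ σ) * fromℕ (n C suc i) - fromℤ σ * fromℕ (n C i)
      ≡⟨ cong₂ _-_ (cong (_* fromℕ (n C suc i)) (fromℤ-* -1ℤ σ)) refl ⟨
    fromℤ σ′ * fromℕ (n C suc i) - fromℤ σ * fromℕ (n C i)
      ≡⟨ cong₂ _-_ (fromℤ-* σ′ (ℤ.+ (n C suc i))) (fromℤ-* σ (ℤ.+ (n C i))) ⟨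
    coeff n (suc i) - coeff n i ∎
    where
    σ  = -1ℤ ℤ.^ i
    σ′ = -1ℤ ℤ.^ suc i

  coeff-last : ∀ n → coeff n (suc n) ≡ 0ℚ
  coeff-last n = trans (cong (λ x → fromℤ (-1ℤ ℤ.^ suc n ℤ.* ℤ.+ x)) (k>n⇒nCk≡0 {n} ℕ.≤-refl))
    (cong fromℤ (ℤ.*-zeroʳ (-1ℤ ℤ.^ suc n)))

  -- The binomial expansion of (x - y)^n, with y^i x^j replaced by g i j.
  binomial : ℕ → (ℕ → ℕ → ℚ) → ℚ
  binomial n g = sum (λ i → coeff n i * g i (n ∸ i)) (suc n)

  -- Multiplication by x - y: raising `j` is multiplication by x, raising `i` by y. On coefficients
  -- it is Pascal's rule.
  binomial-suc : ∀ n g → binomial (suc n) g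
               ≡ binomial n (λ i j → g i (suc j)) - binomial n (λ i j → g (suc i) j)
  binomial-suc n g = begin
    coeff (suc n) 0 * g 0 (suc n) + sum (λ i → coeff (suc n) (suc i) * h i) (suc n)
      ≡⟨ cong₂ _+_ (cong (_* g 0 (suc n)) (trans (coeff-zero (suc n)) (sym (coeff-zero n))))
           (sum-cong (suc n) (λ i _ → trans (cong (_* h i) (coeff-suc n i))
             (solve 3 (λ x y z → (x :- y) :* z := x :* z :- y :* z) refl (coeff n (suc i)) (coeff n i) (h i)))) ⟩
    k 0 + sum (λ i → k (suc i) - coeff n i * h i) (suc n)
      ≡⟨ cong (k 0 +_) (sum-minus (λ i → k (suc i)) (λ i → coeff n i * h i) (suc n)) ⟩
    k 0 + (sum (λ i → k (suc i)) (suc n) - sum (λ i → coeff n i * h i) (suc n))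
      ≡⟨ +-assoc (k 0) _ _ ⟨
    sum k (suc (suc n)) - sum (λ i → coeff n i * h i) (suc n)
      ≡⟨ cong (_- sum (λ i → coeff n i * h i) (suc n)) (begin
           sum k (suc (suc n))
             -- The sum has one term beyond the expansion of degree n; its coefficient is the
             -- binomial of n over n + 1, which is 0.
             ≡⟨ sum-last k (suc n) ⟩
           sum k (suc n) + coeff n (suc n) * g (suc n) (n ∸ n)
             ≡⟨ cong (λ x → sum k (suc n) + x * g (suc n) (n ∸ n)) (coeff-last n) ⟩
           sum k (suc n) + 0ℚ * g (suc n) (n ∸ n)
             ≡⟨ solve 2 (λ x y → x :+ con 0ℚ :* y := x) refl (sum k (suc n)) (g (suc n) (n ∸ n)) ⟩
           sum k (suc n)
             ≡⟨ sum-cong (suc n) (λ { i (s≤s i≤n) → cong (λ j → coeff n i * g i j) (ℕ.+-∸-assoc 1 i≤n) }) ⟩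
           binomial n (λ i j → g i (suc j)) ∎) ⟩
    binomial n (λ i j → g i (suc j)) - binomial n (λ i j → g (suc i) j) ∎
    where
    h : ℕ → ℚ
    h i = g (suc i) (n ∸ i)
    k : ℕ → ℚ
    k i = coeff n i * g i (suc n ∸ i)

  binomial-cong : ∀ n {g h} → (∀ i j → g i j ≡ h i j) → binomial n g ≡ binomial n h
  binomial-cong n g≗h = sum-cong (suc n) (λ i _ → cong (coeff n i *_) (g≗h i (n ∸ i)))

  -- The moment recurrence for super Catalan numbers.

  S-factorials : ∀ a l → S a l * fromℕ (a ! ℕ.* l ! ℕ.* (a ℕ.+ l) !) ≡ fromℕ ((2 ℕ.* a) ! ℕ.* (2 ℕ.* l) !)
  S-factorials a l = begin
    S a l * fromℕ (a ! ℕ.* l ! ℕ.* (a ℕ.+ l) !)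
      ≡⟨ cong (λ x → S a l * fromℕ (a ! ℕ.* l ! ℕ.* x)) ([a+b]Ca*a!*b! a l) ⟨
    S a l * fromℕ (a ! ℕ.* l ! ℕ.* (N ℕ.* (a ! ℕ.* l !)))
      ≡⟨ cong (λ x → S a l * fromℕ x) (solveℕ 3 (λ a l n → a ⊛ l ⊛ (n ⊛ (a ⊛ l))
           :≡ n ⊛ (a ⊛ a ⊛ (l ⊛ l))) refl (a !) (l !) N) ⟩
    S a l * fromℕ (N ℕ.* K)
      ≡⟨ cong (S a l *_) (fromℕ-* N K) ⟩
    S a l * (fromℕ N * fromℕ K)
      ≡⟨ *-assoc (S a l) (fromℕ N) (fromℕ K) ⟨
    S a l * fromℕ N * fromℕ K
      ≡⟨ cong (_* fromℕ K) (/-*-cancel (ℤ.+ (A ℕ.* L)) N {{nCk≢0 (ℕ.m≤m+n a l)}}) ⟩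
    fromℕ (A ℕ.* L) * fromℕ K
      ≡⟨ fromℕ-* (A ℕ.* L) K ⟨
    fromℕ (A ℕ.* L ℕ.* K)
      ≡⟨ cong fromℕ (solveℕ 4 (λ A L x y → A ⊛ L ⊛ (x ⊛ y)
           :≡ (A ⊛ x) ⊛ (L ⊛ y)) refl A L (a ! ℕ.* a !) (l ! ℕ.* l !)) ⟩
    fromℕ ((A ℕ.* (a ! ℕ.* a !)) ℕ.* (L ℕ.* (l ! ℕ.* l !)))
      ≡⟨ cong fromℕ (cong₂ ℕ._*_ (central a) (central l)) ⟩
    fromℕ ((2 ℕ.* a) ! ℕ.* (2 ℕ.* l) !) ∎
    where
    N = (a ℕ.+ l) C a
    K = a ! ℕ.* a ! ℕ.* (l ! ℕ.* l !)
    A = (2 ℕ.* a) C a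
    L = (2 ℕ.* l) C l

  -- The quotient of consecutive values is (2a + 2)(2a + 1) / ((a + 1)(a + l + 1)) by the factorial
  -- formula, and a + 1 cancels.
  S-suc : ∀ l a → (fromℕ (suc l) + fromℕ a) * S (suc a) l ≡ (fromℕ 2 + fromℕ 4 * fromℕ a) * S a l
  -- `K` is a + 1 times the factorial denominator of S(a,l), and `suc l ℕ.+ a` times `K` is that of
  -- S(a+1,l).
  S-suc l a = *-cancelʳ-fromℕ K {{K≢0}} (begin
    (fromℕ (suc l) + fromℕ a) * S (suc a) l * fromℕ K
      ≡⟨ cong (λ x → x * S (suc a) l * fromℕ K) (fromℕ-+ (suc l) a) ⟨
    fromℕ (suc l ℕ.+ a) * S (suc a) l * fromℕ K
      ≡⟨ solve 3 (λ x y z → x :* y :* z := y :* (x :* z)) refl (fromℕ (suc l ℕ.+ a)) (S (suc a) l) (fromℕ K) ⟩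
    S (suc a) l * (fromℕ (suc l ℕ.+ a) * fromℕ K)
      ≡⟨ cong (S (suc a) l *_) (fromℕ-* (suc l ℕ.+ a) K) ⟨
    S (suc a) l * fromℕ ((suc l ℕ.+ a) ℕ.* K)
      ≡⟨ cong (λ x → S (suc a) l * fromℕ x) (solveℕ 5 (λ a l A L C →
           (κ 1 ⊕ l ⊕ a) ⊛ ((κ 1 ⊕ a) ⊛ (A ⊛ L ⊛ C))
           :≡ (κ 1 ⊕ a) ⊛ A ⊛ L ⊛ ((κ 1 ⊕ (a ⊕ l)) ⊛ C)) refl a l (a !) (l !) ((a ℕ.+ l) !)) ⟩
    S (suc a) l * fromℕ (suc a ! ℕ.* l ! ℕ.* (suc a ℕ.+ l) !)
      ≡⟨ S-factorials (suc a) l ⟩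
    fromℕ ((2 ℕ.* suc a) ! ℕ.* (2 ℕ.* l) !)
      ≡⟨ cong (λ x → fromℕ (x ! ℕ.* (2 ℕ.* l) !)) (ℕ.*-suc 2 a) ⟩
    fromℕ (suc (suc (2 ℕ.* a)) ! ℕ.* (2 ℕ.* l) !)
      ≡⟨ cong fromℕ (solveℕ 3 (λ a A L →
           (κ 2 ⊕ κ 2 ⊛ a) ⊛ ((κ 1 ⊕ κ 2 ⊛ a) ⊛ A) ⊛ L
           :≡ (κ 2 ⊕ κ 4 ⊛ a) ⊛ ((κ 1 ⊕ a) ⊛ (A ⊛ L))) refl a ((2 ℕ.* a) !) ((2 ℕ.* l) !)) ⟩
    fromℕ ((2 ℕ.+ 4 ℕ.* a) ℕ.* (suc a ℕ.* ((2 ℕ.* a) ! ℕ.* (2 ℕ.* l) !)))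
      ≡⟨ trans (fromℕ-* (2 ℕ.+ 4 ℕ.* a) (suc a ℕ.* P)) (cong₂ _*_ (2+4a a) (fromℕ-* (suc a) P)) ⟩
    (fromℕ 2 + fromℕ 4 * fromℕ a) * (fromℕ (suc a) * fromℕ ((2 ℕ.* a) ! ℕ.* (2 ℕ.* l) !))
      ≡⟨ cong (λ x → (fromℕ 2 + fromℕ 4 * fromℕ a) * (fromℕ (suc a) * x)) (S-factorials a l) ⟨
    (fromℕ 2 + fromℕ 4 * fromℕ a) * (fromℕ (suc a) * (S a l * fromℕ Q))
      ≡⟨ solve 4 (λ x y s q → x :* (y :* (s :* q)) := x :* s :* (y :* q)) refl
           (fromℕ 2 + fromℕ 4 * fromℕ a) (fromℕ (suc a)) (S a l) (fromℕ Q) ⟩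
    (fromℕ 2 + fromℕ 4 * fromℕ a) * S a l * (fromℕ (suc a) * fromℕ Q)
      ≡⟨ cong ((fromℕ 2 + fromℕ 4 * fromℕ a) * S a l *_) (fromℕ-* (suc a) Q) ⟨
    (fromℕ 2 + fromℕ 4 * fromℕ a) * S a l * fromℕ K ∎)
    where
    P = (2 ℕ.* a) ! ℕ.* (2 ℕ.* l) !
    Q = a ! ℕ.* l ! ℕ.* (a ℕ.+ l) !
    K = suc a ℕ.* Q
    2+4a : ∀ a → fromℕ (2 ℕ.+ 4 ℕ.* a) ≡ fromℕ 2 + fromℕ 4 * fromℕ a
    2+4a a = trans (fromℕ-+ 2 (4 ℕ.* a)) (cong (fromℕ 2 +_) (fromℕ-* 4 a))
    K≢0 : NonZero K
    K≢0 = ℕ.m*n≢0 (suc a) Q {{_}} {{ℕ.m*n≢0 _ _ {{ℕ.m*n≢0 _ _ {{a ℕ.!≢0}} {{l ℕ.!≢0}}}} {{(a ℕ.+ l) ℕ.!≢0}}}}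

  -- Closed form of the even diagonal moments.

  module _ (l : ℕ) where

    open Moments (λ a → S a l) fromℕ (fromℕ (suc l)) (fromℕ 2) (fromℕ 4) refl (fromℕ-+ 1) (S-suc l) public

    -- Both sides obey the same recursion in N, multiplication by x - y. It shifts the exponents,
    -- hence the general `a` and `b`.
    T-binomial : ∀ N a b → T N a b ≡ binomial N (λ i j → S (b ℕ.+ i) l * S (a ℕ.+ j) l)
    T-binomial zero a b = begin
      S a l * S b l
        ≡⟨ *-comm (S a l) (S b l) ⟩
      S b l * S a l
        ≡⟨ cong₂ (λ x y → S x l * S y l) (ℕ.+-identityʳ b) (ℕ.+-identityʳ a) ⟨
      p
        ≡⟨ solve 1 (λ x → x := con 1ℚ :* x :+ con 0ℚ) refl p ⟩
      1ℚ * p + 0ℚ ∎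
      where p = S (b ℕ.+ 0) l * S (a ℕ.+ 0) l
    T-binomial (suc N) a b = begin
      T N (suc a) b - T N a (suc b)
        ≡⟨ cong₂ _-_
             (trans (T-binomial N (suc a) b) (binomial-cong N (λ i j →
               cong (λ x → S (b ℕ.+ i) l * S x l) (sym (ℕ.+-suc a j)))))
             (trans (T-binomial N a (suc b)) (binomial-cong N (λ i j →
               cong (λ x → S x l * S (a ℕ.+ j) l) (sym (ℕ.+-suc b i))))) ⟩
      binomial N (λ i j → g i (suc j)) - binomial N (λ i j → g (suc i) j)
        ≡⟨ binomial-suc N g ⟨
      binomial (suc N) g ∎
      where
      g : ℕ → ℕ → ℚ
      g i j = S (b ℕ.+ i) l * S (a ℕ.+ j) l

    -- The exponent is written `m ℕ.* 2` because `suc m ℕ.* 2` computes to two successors, matching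
    -- `Even.step` and letting factorials unfold.
    sign-even : ∀ m → sign (m ℕ.* 2) ≡ 1ℚ
    sign-even zero    = refl
    sign-even (suc m) = cong (λ s → - - s) (sign-even m)

    -- The two factors of `Even.step` as natural numbers. In `e * β - δ + e * μ` the terms in t
    -- cancel, leaving 2 + 4l + 4m without subtraction.
    step-den step-num : ℕ → ℕ → ℕ
    step-den t m = (suc l ℕ.+ t ℕ.+ m) ℕ.* (suc l ℕ.+ t ℕ.+ (m ℕ.+ m)) ℕ.* (suc l ℕ.+ t ℕ.+ (m ℕ.+ m) ℕ.+ 1)
    step-num t m = 2 ℕ.* (m ℕ.+ m ℕ.+ 1) ℕ.* (2 ℕ.+ 4 ℕ.* t ℕ.+ 4 ℕ.* m) ℕ.* (2 ℕ.+ 4 ℕ.* l ℕ.+ 4 ℕ.* m)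

    module _ (t m : ℕ) where
      private
        L = fromℕ l
        τ = fromℕ t
        μ = fromℕ m
        β = fromℕ (suc l) + τ
        δ = fromℕ 2 + fromℕ 4 * τ

      [β+x] : ∀ x → fromℕ (suc l ℕ.+ t ℕ.+ x) ≡ β + fromℕ x
      [β+x] x = trans (fromℕ-+ (suc l ℕ.+ t) x) (cong (_+ fromℕ x) (fromℕ-+ (suc l) t))

      2+4x+4m : ∀ x → fromℕ (2 ℕ.+ 4 ℕ.* x ℕ.+ 4 ℕ.* m) ≡ (fromℕ 2 + fromℕ 4 * fromℕ x) + fromℕ 4 * μ
      2+4x+4m x = trans (fromℕ-+ (2 ℕ.+ 4 ℕ.* x) (4 ℕ.* m)) (cong₂ _+_
        (trans (fromℕ-+ 2 (4 ℕ.* x)) (cong (fromℕ 2 +_) (fromℕ-* 4 x))) (fromℕ-* 4 m))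

      [β+2m] : fromℕ (suc l ℕ.+ t ℕ.+ (m ℕ.+ m)) ≡ β + (μ + μ)
      [β+2m] = trans ([β+x] (m ℕ.+ m)) (cong (β +_) (fromℕ-+ m m))

      fromℕ-step-den : fromℕ (step-den t m) ≡ (β + μ) * (β + (μ + μ)) * (β + (μ + μ) + 1ℚ)
      fromℕ-step-den = trans (fromℕ-* (p ℕ.* q) (q ℕ.+ 1)) (cong₂ _*_
          (trans (fromℕ-* p q) (cong₂ _*_ ([β+x] m) [β+2m]))
          (trans (fromℕ-+ q 1) (cong (_+ 1ℚ) [β+2m])))
        where
        p = suc l ℕ.+ t ℕ.+ m
        q = suc l ℕ.+ t ℕ.+ (m ℕ.+ m)

      4β-δ+4μ : fromℕ (2 ℕ.+ 4 ℕ.* l ℕ.+ 4 ℕ.* m) ≡ fromℕ 4 * β - δ + fromℕ 4 * μ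
      4β-δ+4μ = begin
        fromℕ (2 ℕ.+ 4 ℕ.* l ℕ.+ 4 ℕ.* m)
          ≡⟨ 2+4x+4m l ⟩
        (fromℕ 2 + fromℕ 4 * L) + fromℕ 4 * μ
          ≡⟨ solve 3 (λ L τ μ → (con (fromℕ 2) :+ con (fromℕ 4) :* L) :+ con (fromℕ 4) :* μ
               := con (fromℕ 4) :* ((con 1ℚ :+ L) :+ τ) :- (con (fromℕ 2) :+ con (fromℕ 4) :* τ)
                  :+ con (fromℕ 4) :* μ) refl L τ μ ⟩
        fromℕ 4 * ((1ℚ + L) + τ) - δ + fromℕ 4 * μ
          ≡⟨ cong (λ x → fromℕ 4 * (x + τ) - δ + fromℕ 4 * μ) (fromℕ-+ 1 l) ⟨
        fromℕ 4 * β - δ + fromℕ 4 * μ ∎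

      fromℕ-step-num : fromℕ (step-num t m)
             ≡ (1ℚ + 1ℚ) * ((μ + μ) + 1ℚ) * (δ + fromℕ 4 * μ) * (fromℕ 4 * β - δ + fromℕ 4 * μ)
      fromℕ-step-num = trans (fromℕ-* (2 ℕ.* p ℕ.* q) r) (cong₂ _*_
          (trans (fromℕ-* (2 ℕ.* p) q) (cong₂ _*_
            (trans (fromℕ-* 2 p) (cong ((1ℚ + 1ℚ) *_)
              (trans (fromℕ-+ (m ℕ.+ m) 1) (cong (_+ 1ℚ) (fromℕ-+ m m)))))
            (2+4x+4m t)))
          4β-δ+4μ)
        where
        p = m ℕ.+ m ℕ.+ 1
        q = 2 ℕ.+ 4 ℕ.* t ℕ.+ 4 ℕ.* m
        r = 2 ℕ.+ 4 ℕ.* l ℕ.+ 4 ℕ.* m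

      T-recurrence : T (suc m ℕ.* 2) t t * fromℕ (step-den t m) ≡ T (m ℕ.* 2) t t * fromℕ (step-num t m)
      T-recurrence = begin
        T (suc m ℕ.* 2) t t * fromℕ (step-den t m)
          ≡⟨ cong (T (suc m ℕ.* 2) t t *_) fromℕ-step-den ⟩
        T (suc m ℕ.* 2) t t * ((β + μ) * (β + (μ + μ)) * (β + (μ + μ) + 1ℚ))
          ≡⟨ Even.step (m ℕ.* 2) (sign-even m) μ ιN≡2μ t ⟩
        T (m ℕ.* 2) t t * ((1ℚ + 1ℚ) * ((μ + μ) + 1ℚ) * (δ + fromℕ 4 * μ) * (fromℕ 4 * β - δ + fromℕ 4 * μ))
          ≡⟨ cong (T (m ℕ.* 2) t t *_) fromℕ-step-num ⟨
        T (m ℕ.* 2) t t * fromℕ (step-num t m) ∎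
        where
        ιN≡2μ : fromℕ (m ℕ.* 2) ≡ μ + μ
        ιN≡2μ = trans (cong fromℕ (solveℕ 1 (λ m → m ⊛ κ 2 :≡ m ⊕ m) refl m)) (fromℕ-+ m m)

    -- Numerator and denominator of the solution of the recurrence in m that starts from S(t,l)^2 at
    -- m = 0.
    num den : ℕ → ℕ → ℕ
    num t m = (l ℕ.* 2) ! ℕ.* (t ℕ.* 2) ! ℕ.* ((m ℕ.+ l) ℕ.* 2) ! ℕ.* ((m ℕ.+ t) ℕ.* 2) ! ℕ.* (m ℕ.* 2) !
    den t m = l ! ℕ.* t ! ℕ.* (m ℕ.+ l) ! ℕ.* (m ℕ.+ t) ! ℕ.* m !
              ℕ.* (m ℕ.+ t ℕ.+ l) ! ℕ.* (m ℕ.* 2 ℕ.+ t ℕ.+ l) !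

    -- Passing from m to m + 1 multiplies `num` and `den` by `step-num` and `step-den` only up to
    -- this shared factor: (2k + 2)! contributes 2(k + 1) and (k + 1)! contributes k + 1, for k = m
    -- + l, m + t and m.
    common-factor : ℕ → ℕ → ℕ
    common-factor t m = suc (m ℕ.+ l) ℕ.* suc (m ℕ.+ t) ℕ.* suc m

    den-suc : ∀ t m → den t (suc m) ≡ step-den t m ℕ.* (common-factor t m ℕ.* den t m)
    den-suc t m = solveℕ 10 (λ l t m L T A B M C D →
        L ⊛ T ⊛ ((κ 1 ⊕ (m ⊕ l)) ⊛ A) ⊛ ((κ 1 ⊕ (m ⊕ t)) ⊛ B) ⊛ ((κ 1 ⊕ m) ⊛ M)
          ⊛ ((κ 1 ⊕ (m ⊕ t ⊕ l)) ⊛ C)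
          ⊛ ((κ 2 ⊕ (m ⊛ κ 2 ⊕ t ⊕ l)) ⊛ ((κ 1 ⊕ (m ⊛ κ 2 ⊕ t ⊕ l)) ⊛ D))
        :≡ ((κ 1 ⊕ l) ⊕ t ⊕ m) ⊛ ((κ 1 ⊕ l) ⊕ t ⊕ (m ⊕ m)) ⊛ ((κ 1 ⊕ l) ⊕ t ⊕ (m ⊕ m) ⊕ κ 1)
          ⊛ (((κ 1 ⊕ (m ⊕ l)) ⊛ (κ 1 ⊕ (m ⊕ t)) ⊛ (κ 1 ⊕ m)) ⊛ (L ⊛ T ⊛ A ⊛ B ⊛ M ⊛ C ⊛ D))) refl
      l t m (l !) (t !) ((m ℕ.+ l) !) ((m ℕ.+ t) !) (m !) ((m ℕ.+ t ℕ.+ l) !) ((m ℕ.* 2 ℕ.+ t ℕ.+ l) !)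

    num-suc : ∀ t m → num t (suc m) ≡ step-num t m ℕ.* (common-factor t m ℕ.* num t m)
    num-suc t m = solveℕ 8 (λ l t m L T A B M →
        L ⊛ T ⊛ ((κ 2 ⊕ (m ⊕ l) ⊛ κ 2) ⊛ ((κ 1 ⊕ (m ⊕ l) ⊛ κ 2) ⊛ A))
          ⊛ ((κ 2 ⊕ (m ⊕ t) ⊛ κ 2) ⊛ ((κ 1 ⊕ (m ⊕ t) ⊛ κ 2) ⊛ B))
          ⊛ ((κ 2 ⊕ m ⊛ κ 2) ⊛ ((κ 1 ⊕ m ⊛ κ 2) ⊛ M))
        :≡ κ 2 ⊛ (m ⊕ m ⊕ κ 1) ⊛ (κ 2 ⊕ κ 4 ⊛ t ⊕ κ 4 ⊛ m) ⊛ (κ 2 ⊕ κ 4 ⊛ l ⊕ κ 4 ⊛ m)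
          ⊛ (((κ 1 ⊕ (m ⊕ l)) ⊛ (κ 1 ⊕ (m ⊕ t)) ⊛ (κ 1 ⊕ m)) ⊛ (L ⊛ T ⊛ A ⊛ B ⊛ M))) refl
      l t m ((l ℕ.* 2) !) ((t ℕ.* 2) !) (((m ℕ.+ l) ℕ.* 2) !) (((m ℕ.+ t) ℕ.* 2) !) ((m ℕ.* 2) !)

    -- Induction on m. The factor `step-den` of the new denominator is just what `T-recurrence`
    -- consumes, so no division occurs.
    closed-form : ∀ t m → T (m ℕ.* 2) t t * fromℕ (den t m) ≡ fromℕ (num t m)
    closed-form t zero = begin
      S t l * S t l * fromℕ (den t 0)
        ≡⟨ cong (λ x → S t l * S t l * fromℕ x) (solveℕ 3 (λ L T C →
             L ⊛ T ⊛ L ⊛ T ⊛ κ 1 ⊛ C ⊛ C :≡ (T ⊛ L ⊛ C) ⊛ (T ⊛ L ⊛ C)) refl (l !) (t !) ((t ℕ.+ l) !)) ⟩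
      S t l * S t l * fromℕ (d ℕ.* d)
        ≡⟨ cong (S t l * S t l *_) (fromℕ-* d d) ⟩
      S t l * S t l * (fromℕ d * fromℕ d)
        ≡⟨ solve 2 (λ s d → s :* s :* (d :* d) := (s :* d) :* (s :* d)) refl (S t l) (fromℕ d) ⟩
      (S t l * fromℕ d) * (S t l * fromℕ d)
        ≡⟨ cong₂ _*_ (S-factorials t l) (S-factorials t l) ⟩
      fromℕ n * fromℕ n
        ≡⟨ fromℕ-* n n ⟨
      fromℕ (n ℕ.* n)
        ≡⟨ cong fromℕ (cong (λ x → x ℕ.* x) (cong₂ (λ x y → x ! ℕ.* y !) (ℕ.*-comm 2 t) (ℕ.*-comm 2 l))) ⟩
      fromℕ ((t ℕ.* 2) ! ℕ.* (l ℕ.* 2) ! ℕ.* ((t ℕ.* 2) ! ℕ.* (l ℕ.* 2) !))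
        ≡⟨ cong fromℕ (solveℕ 2 (λ T L → T ⊛ L ⊛ (T ⊛ L) :≡ L ⊛ T ⊛ L ⊛ T ⊛ κ 1) refl ((t ℕ.* 2) !) ((l ℕ.* 2) !)) ⟩
      fromℕ (num t 0) ∎
      where
      d = t ! ℕ.* l ! ℕ.* (t ℕ.+ l) !
      n = (2 ℕ.* t) ! ℕ.* (2 ℕ.* l) !
    closed-form t (suc m) = begin
      F′ * fromℕ (den t (suc m))
        ≡⟨ cong (λ x → F′ * fromℕ x) (den-suc t m) ⟩
      F′ * fromℕ (p ℕ.* (k ℕ.* den t m))
        ≡⟨ cong (F′ *_) (trans (fromℕ-* p (k ℕ.* den t m)) (cong (fromℕ p *_) (fromℕ-* k (den t m)))) ⟩
      F′ * (fromℕ p * (fromℕ k * fromℕ (den t m)))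
        ≡⟨ *-assoc F′ (fromℕ p) (fromℕ k * fromℕ (den t m)) ⟨
      F′ * fromℕ p * (fromℕ k * fromℕ (den t m))
        ≡⟨ cong (_* (fromℕ k * fromℕ (den t m))) (T-recurrence t m) ⟩
      F * fromℕ q * (fromℕ k * fromℕ (den t m))
        ≡⟨ solve 4 (λ F q k d → F :* q :* (k :* d) := q :* (k :* (F :* d))) refl
             F (fromℕ q) (fromℕ k) (fromℕ (den t m)) ⟩
      fromℕ q * (fromℕ k * (F * fromℕ (den t m)))
        ≡⟨ cong (λ x → fromℕ q * (fromℕ k * x)) (closed-form t m) ⟩
      fromℕ q * (fromℕ k * fromℕ (num t m))
        ≡⟨ trans (fromℕ-* q (k ℕ.* num t m)) (cong (fromℕ q *_) (fromℕ-* k (num t m))) ⟨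
      fromℕ (q ℕ.* (k ℕ.* num t m))
        ≡⟨ cong fromℕ (num-suc t m) ⟨
      fromℕ (num t (suc m)) ∎
      where
      F′ = T (suc m ℕ.* 2) t t
      F  = T (m ℕ.* 2) t t
      p  = step-den t m
      q  = step-num t m
      k  = common-factor t m

  -- Matching both sides of the theorem with the closed form, for n = m + t.

  n+l∸t : ∀ l t m → m ℕ.+ t ℕ.+ l ∸ t ≡ m ℕ.+ l
  n+l∸t l t m = begin
    m ℕ.+ t ℕ.+ l ∸ t      ≡⟨ cong (_∸ t) (solveℕ 3 (λ m t l → m ⊕ t ⊕ l :≡ t ⊕ (m ⊕ l)) refl m t l) ⟩
    t ℕ.+ (m ℕ.+ l) ∸ t    ≡⟨ ℕ.m+n∸m≡n t (m ℕ.+ l) ⟩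
    m ℕ.+ l                ∎

  2n∸2t : ∀ t m → 2 ℕ.* (m ℕ.+ t) ∸ 2 ℕ.* t ≡ 2 ℕ.* m
  2n∸2t t m = trans (sym (ℕ.*-distribˡ-∸ 2 (m ℕ.+ t) t)) (cong (2 ℕ.*_) (ℕ.m+n∸n≡m m t))

  2n+l∸t : ∀ l t m → 2 ℕ.* (m ℕ.+ t) ℕ.+ l ∸ t ≡ m ℕ.+ t ℕ.+ (m ℕ.+ l)
  2n+l∸t l t m = begin
    2 ℕ.* (m ℕ.+ t) ℕ.+ l ∸ t
      ≡⟨ cong (_∸ t) (solveℕ 3 (λ m t l → κ 2 ⊛ (m ⊕ t) ⊕ l :≡ t ⊕ (m ⊕ t ⊕ (m ⊕ l))) refl m t l) ⟩
    t ℕ.+ (m ℕ.+ t ℕ.+ (m ℕ.+ l)) ∸ t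
      ≡⟨ ℕ.m+n∸m≡n t (m ℕ.+ t ℕ.+ (m ℕ.+ l)) ⟩
    m ℕ.+ t ℕ.+ (m ℕ.+ l) ∎

  alternatingSum : ℕ → ℕ → ℕ → ℚ
  alternatingSum n l t = ∑[ k from t to (2 ℕ.* n ∸ t) ]
    ((((-1ℤ ℤ.^ k) ℤ.* (ℤ.+ ((2 ℕ.* n ∸ 2 ℕ.* t) C (k ∸ t)))) / 1) * S k l * S (2 ℕ.* n ∸ k) l)

  -- Substituting k = t + i turns the sum into (-1)^t times the expansion of (x - y)^(2m) against
  -- (xy)^t.
  sum-as-moment : ∀ l t m → alternatingSum (m ℕ.+ t) l t ≡ fromℤ (-1ℤ ℤ.^ t) * T l (m ℕ.* 2) t t
  sum-as-moment l t m = begin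
    sum f (suc (2n ∸ t) ∸ t)
      ≡⟨ cong (sum f) length≡ ⟩
    sum f (suc N)
      ≡⟨ sum-cong (suc N) (λ { i (s≤s i≤N) → term i i≤N }) ⟩
    sum (λ i → fromℤ (-1ℤ ℤ.^ t) * (coeff N i * (S (t ℕ.+ i) l * S (t ℕ.+ (N ∸ i)) l))) (suc N)
      ≡⟨ sum-distribˡ (fromℤ (-1ℤ ℤ.^ t)) (λ i → coeff N i * (S (t ℕ.+ i) l * S (t ℕ.+ (N ∸ i)) l)) (suc N) ⟩
    fromℤ (-1ℤ ℤ.^ t) * binomial N (λ i j → S (t ℕ.+ i) l * S (t ℕ.+ j) l)
      ≡⟨ cong (fromℤ (-1ℤ ℤ.^ t) *_) (T-binomial l N t t) ⟨
    fromℤ (-1ℤ ℤ.^ t) * T l N t t ∎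
    where
    N = m ℕ.* 2
    2n = 2 ℕ.* (m ℕ.+ t)
    f : ℕ → ℚ
    f i = fromℤ ((-1ℤ ℤ.^ (t ℕ.+ i)) ℤ.* (ℤ.+ ((2n ∸ 2 ℕ.* t) C (t ℕ.+ i ∸ t))))
          * S (t ℕ.+ i) l * S (2n ∸ (t ℕ.+ i)) l

    2n≡ : 2n ≡ t ℕ.+ (t ℕ.+ N)
    2n≡ = solveℕ 2 (λ m t → κ 2 ⊛ (m ⊕ t) :≡ t ⊕ (t ⊕ m ⊛ κ 2)) refl m t

    -- Both endpoints count, so there are 2m + 1 terms, one for each i from 0 to 2m.
    length≡ : suc (2n ∸ t) ∸ t ≡ suc N
    length≡ = begin
      suc (2n ∸ t) ∸ t                ≡⟨ cong (λ x → suc (x ∸ t) ∸ t) 2n≡ ⟩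
      suc (t ℕ.+ (t ℕ.+ N) ∸ t) ∸ t   ≡⟨ cong (λ x → suc x ∸ t) (ℕ.m+n∸m≡n t (t ℕ.+ N)) ⟩
      suc (t ℕ.+ N) ∸ t               ≡⟨ cong (_∸ t) (ℕ.+-suc t N) ⟨
      t ℕ.+ suc N ∸ t                 ≡⟨ ℕ.m+n∸m≡n t (suc N) ⟩
      suc N                           ∎

    degree≡ : 2n ∸ 2 ℕ.* t ≡ N
    degree≡ = trans (2n∸2t t m) (ℕ.*-comm 2 m)

    index≡ : ∀ i → i ≤ N → 2n ∸ (t ℕ.+ i) ≡ t ℕ.+ (N ∸ i)
    index≡ i i≤N = begin
      2n ∸ (t ℕ.+ i)                 ≡⟨ cong (_∸ (t ℕ.+ i)) 2n≡ ⟩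
      t ℕ.+ (t ℕ.+ N) ∸ (t ℕ.+ i)    ≡⟨ ℕ.[m+n]∸[m+o]≡n∸o t (t ℕ.+ N) i ⟩
      t ℕ.+ N ∸ i                    ≡⟨ ℕ.+-∸-assoc t i≤N ⟩
      t ℕ.+ (N ∸ i)                  ∎

    coeff≡ : ∀ i → fromℤ ((-1ℤ ℤ.^ (t ℕ.+ i)) ℤ.* (ℤ.+ ((2n ∸ 2 ℕ.* t) C (t ℕ.+ i ∸ t))))
                 ≡ fromℤ (-1ℤ ℤ.^ t) * coeff N i
    coeff≡ i = begin
      fromℤ ((-1ℤ ℤ.^ (t ℕ.+ i)) ℤ.* (ℤ.+ ((2n ∸ 2 ℕ.* t) C (t ℕ.+ i ∸ t))))
        ≡⟨ cong fromℤ (cong₂ (λ x y → x ℤ.* ℤ.+ y) (ℤ.^-distribˡ-+-* -1ℤ t i)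
             (cong₂ _C_ degree≡ (ℕ.m+n∸m≡n t i))) ⟩
      fromℤ ((-1ℤ ℤ.^ t ℤ.* -1ℤ ℤ.^ i) ℤ.* ℤ.+ (N C i))
        ≡⟨ cong fromℤ (ℤ.*-assoc (-1ℤ ℤ.^ t) (-1ℤ ℤ.^ i) (ℤ.+ (N C i))) ⟩
      fromℤ (-1ℤ ℤ.^ t ℤ.* (-1ℤ ℤ.^ i ℤ.* ℤ.+ (N C i)))
        ≡⟨ fromℤ-* (-1ℤ ℤ.^ t) (-1ℤ ℤ.^ i ℤ.* ℤ.+ (N C i)) ⟩
      fromℤ (-1ℤ ℤ.^ t) * coeff N i ∎

    term : ∀ i → i ≤ N → f i ≡ fromℤ (-1ℤ ℤ.^ t) * (coeff N i * (S (t ℕ.+ i) l * S (t ℕ.+ (N ∸ i)) l))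
    term i i≤N = trans
      (cong₂ (λ x y → x * S (t ℕ.+ i) l * S y l) (coeff≡ i) (index≡ i i≤N))
      (solve 4 (λ s c x y → s :* c :* x :* y := s :* (c :* (x :* y))) refl
        (fromℤ (-1ℤ ℤ.^ t)) (coeff N i) (S (t ℕ.+ i) l) (S (t ℕ.+ (N ∸ i)) l))

  -- The quotient of the theorem at n = m + t, without its sign.
  rhs-num rhs-den : ℕ → ℕ → ℕ → ℕ
  rhs-num l t m = ((2 ℕ.* l) C l) ℕ.* ((2 ℕ.* t) C t) ℕ.* ((2 ℕ.* (m ℕ.+ l)) C (m ℕ.+ l))
    ℕ.* ((2 ℕ.* (m ℕ.+ t)) C (m ℕ.+ t)) ℕ.* ((2 ℕ.* m) C m)
  rhs-den l t m = ((m ℕ.+ t ℕ.+ l) C (m ℕ.+ t)) ℕ.* ((m ℕ.+ t ℕ.+ (m ℕ.+ l)) C (m ℕ.+ t)) ℕ.* ((m ℕ.+ t) C t)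

  -- The factor turning the binomials of the theorem into the factorials of closed-form.
  scale : ℕ → ℕ → ℕ → ℕ
  scale l t m = (l ! ℕ.* l !) ℕ.* (t ! ℕ.* t !) ℕ.* ((m ℕ.+ l) ! ℕ.* (m ℕ.+ l) !)
    ℕ.* ((m ℕ.+ t) ! ℕ.* (m ℕ.+ t) !) ℕ.* (m ! ℕ.* m !)

  rhs-num-scale : ∀ l t m → rhs-num l t m ℕ.* scale l t m ≡ num l t m
  rhs-num-scale l t m = begin
    rhs-num l t m ℕ.* scale l t m
      ≡⟨ solveℕ 10 (λ a b c d e a′ b′ c′ d′ e′ →
           (a ⊛ b ⊛ c ⊛ d ⊛ e) ⊛ (a′ ⊛ b′ ⊛ c′ ⊛ d′ ⊛ e′)
           :≡ (a ⊛ a′) ⊛ (b ⊛ b′) ⊛ (c ⊛ c′) ⊛ (d ⊛ d′) ⊛ (e ⊛ e′)) refl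
           (C₂ l) (C₂ t) (C₂ (m ℕ.+ l)) (C₂ (m ℕ.+ t)) (C₂ m)
           (l ! ℕ.* l !) (t ! ℕ.* t !) ((m ℕ.+ l) ! ℕ.* (m ℕ.+ l) !) ((m ℕ.+ t) ! ℕ.* (m ℕ.+ t) !) (m ! ℕ.* m !) ⟩
    (C₂ l ℕ.* (l ! ℕ.* l !)) ℕ.* (C₂ t ℕ.* (t ! ℕ.* t !)) ℕ.* (C₂ (m ℕ.+ l) ℕ.* ((m ℕ.+ l) ! ℕ.* (m ℕ.+ l) !))
      ℕ.* (C₂ (m ℕ.+ t) ℕ.* ((m ℕ.+ t) ! ℕ.* (m ℕ.+ t) !)) ℕ.* (C₂ m ℕ.* (m ! ℕ.* m !))
      ≡⟨ cong₂ ℕ._*_ (cong₂ ℕ._*_ (cong₂ ℕ._*_ (cong₂ ℕ._*_ (central′ l) (central′ t))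
           (central′ (m ℕ.+ l))) (central′ (m ℕ.+ t))) (central′ m) ⟩
    num l t m ∎
    where
    C₂ : ℕ → ℕ
    C₂ a = (2 ℕ.* a) C a
    central′ : ∀ a → C₂ a ℕ.* (a ! ℕ.* a !) ≡ (a ℕ.* 2) !
    central′ a = trans (central a) (cong _! (ℕ.*-comm 2 a))

  rhs-den-scale : ∀ l t m → rhs-den l t m ℕ.* scale l t m ≡ den l t m
  rhs-den-scale l t m = begin
    (a ℕ.* b ℕ.* c) ℕ.* scale l t m
      -- Each binomial takes the two factorials of its own denominator; one copy each of l!, t!, (m
      -- + l)! and m! is left over.
      ≡⟨ solveℕ 8 (λ a b c L T A B M →
           (a ⊛ b ⊛ c) ⊛ ((L ⊛ L) ⊛ (T ⊛ T) ⊛ (A ⊛ A) ⊛ (B ⊛ B) ⊛ (M ⊛ M))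
           :≡ L ⊛ T ⊛ A ⊛ (c ⊛ (T ⊛ M)) ⊛ M ⊛ (a ⊛ (B ⊛ L)) ⊛ (b ⊛ (B ⊛ A))) refl
           a b c (l !) (t !) ((m ℕ.+ l) !) ((m ℕ.+ t) !) (m !) ⟩
    l ! ℕ.* t ! ℕ.* (m ℕ.+ l) ! ℕ.* (c ℕ.* (t ! ℕ.* m !)) ℕ.* m !
      ℕ.* (a ℕ.* ((m ℕ.+ t) ! ℕ.* l !)) ℕ.* (b ℕ.* ((m ℕ.+ t) ! ℕ.* (m ℕ.+ l) !))
      ≡⟨ cong₂ ℕ._*_ (cong₂ ℕ._*_ (cong (λ x → l ! ℕ.* t ! ℕ.* (m ℕ.+ l) ! ℕ.* x ℕ.* m !)
             (subst (λ n → (n C t) ℕ.* (t ! ℕ.* m !) ≡ n !) (ℕ.+-comm t m) ([a+b]Ca*a!*b! t m)))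
           ([a+b]Ca*a!*b! (m ℕ.+ t) l))
           (trans ([a+b]Ca*a!*b! (m ℕ.+ t) (m ℕ.+ l))
             (cong _! (solveℕ 3 (λ m t l → m ⊕ t ⊕ (m ⊕ l) :≡ m ⊛ κ 2 ⊕ t ⊕ l) refl m t l))) ⟩
    den l t m ∎
    where
    a = (m ℕ.+ t ℕ.+ l) C (m ℕ.+ t)
    b = (m ℕ.+ t ℕ.+ (m ℕ.+ l)) C (m ℕ.+ t)
    c = (m ℕ.+ t) C t

  scale≢0 : ∀ l t m → NonZero (scale l t m)
  scale≢0 l t m = (sq l ⊗ sq t ⊗ sq (m ℕ.+ l) ⊗ sq (m ℕ.+ t) ⊗ sq m)
    where
    infixl 7 _⊗_
    _⊗_ : ∀ {x y} → NonZero x → NonZero y → NonZero (x ℕ.* y)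
    _⊗_ {x} {y} p q = ℕ.m*n≢0 x y {{p}} {{q}}
    sq : ∀ a → NonZero (a ! ℕ.* a !)
    sq a = (a ℕ.!≢0) ⊗ (a ℕ.!≢0)

  T-rhs : ∀ l t m → T l (m ℕ.* 2) t t * fromℕ (rhs-den l t m) ≡ fromℕ (rhs-num l t m)
  T-rhs l t m = *-cancelʳ-fromℕ s {{scale≢0 l t m}} (begin
    F * fromℕ d * fromℕ s     ≡⟨ *-assoc F (fromℕ d) (fromℕ s) ⟩
    F * (fromℕ d * fromℕ s)   ≡⟨ cong (F *_) (fromℕ-* d s) ⟨
    F * fromℕ (d ℕ.* s)       ≡⟨ cong (λ x → F * fromℕ x) (rhs-den-scale l t m) ⟩
    F * fromℕ (den l t m)     ≡⟨ closed-form l t m ⟩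
    fromℕ (num l t m)         ≡⟨ cong fromℕ (rhs-num-scale l t m) ⟨
    fromℕ (n ℕ.* s)           ≡⟨ fromℕ-* n s ⟩
    fromℕ n * fromℕ s         ∎)
    where
    F = T l (m ℕ.* 2) t t
    s = scale l t m
    d = rhs-den l t m
    n = rhs-num l t m

  numerator : ℕ → ℕ → ℕ → ℤ
  numerator n l t = (-1ℤ ℤ.^ t) ℤ.* (ℤ.+ (((2 ℕ.* l) C l) ℕ.* ((2 ℕ.* t) C t)
    ℕ.* ((2 ℕ.* (n ℕ.+ l ∸ t)) C (n ℕ.+ l ∸ t)) ℕ.* ((2 ℕ.* n) C n) ℕ.* ((2 ℕ.* n ∸ 2 ℕ.* t) C (n ∸ t))))

  denominator : ℕ → ℕ → ℕ → ℕ
  denominator n l t = ((n ℕ.+ l) C n) ℕ.* ((2 ℕ.* n ℕ.+ l ∸ t) C n) ℕ.* (n C t)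

  -- With the equation `m ℕ.+ t ≡ n` as an argument, matching on `refl` replaces n by m + t
  -- throughout, and the truncated subtractions become exact.
  cleared-sum : ∀ n l t m → m ℕ.+ t ≡ n → alternatingSum n l t * fromℕ (denominator n l t) ≡ fromℤ (numerator n l t)
  cleared-sum n l t m refl = begin
    alternatingSum n l t * fromℕ (denominator n l t)
      ≡⟨ cong₂ (λ x y → x * fromℕ (((n ℕ.+ l) C n) ℕ.* (y C n) ℕ.* (n C t))) (sum-as-moment l t m) (2n+l∸t l t m) ⟩
    σ * T l (m ℕ.* 2) t t * fromℕ (rhs-den l t m)
      ≡⟨ *-assoc σ (T l (m ℕ.* 2) t t) (fromℕ (rhs-den l t m)) ⟩
    σ * (T l (m ℕ.* 2) t t * fromℕ (rhs-den l t m))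
      ≡⟨ cong (σ *_) (T-rhs l t m) ⟩
    σ * fromℕ (rhs-num l t m)
      ≡⟨ fromℤ-* (-1ℤ ℤ.^ t) (ℤ.+ rhs-num l t m) ⟨
    fromℤ (-1ℤ ℤ.^ t ℤ.* ℤ.+ rhs-num l t m)
      ≡⟨ cong (λ x → fromℤ (-1ℤ ℤ.^ t ℤ.* ℤ.+ x))
           (cong₂ (λ x y → ((2 ℕ.* l) C l) ℕ.* ((2 ℕ.* t) C t) ℕ.* x ℕ.* ((2 ℕ.* n) C n) ℕ.* y)
             (cong (λ x → (2 ℕ.* x) C x) (n+l∸t l t m)) (cong₂ _C_ (2n∸2t t m) (ℕ.m+n∸n≡m m t))) ⟨
    fromℤ (numerator n l t) ∎
    where
    σ = fromℤ (-1ℤ ℤ.^ t)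

open import Data.Nat.Base using (ℕ; _+_; _*_; _∸_; _≤_)
open import Data.Nat.Combinatorics using (_C_)
open import Data.Integer.Base using (+_; -1ℤ; _^_) renaming (_*_ to _*ℤ_)
open import Data.Rational.Base using (_/_) renaming (_*_ to _*ℚ_)
open import Relation.Binary.PropositionalEquality using (_≡_)
open import Data.Nat.Properties using (m∸n+n≡m)
open SuperCatalanSum using (≡-/; numerator; denominator; cleared-sum)

theorem2 : (n l t : ℕ) (t≤n : t ≤ n) →
    (∑[ k from t to (2 * n ∸ t) ] ((((-1ℤ ^ k) *ℤ (+ ((2 * n ∸ 2 * t) C (k ∸ t)))) / 1) *ℚ S k l *ℚ S (2 * n ∸ k) l))
    ≡ _/_ ((-1ℤ ^ t) *ℤ (+ (((2 * l) C l) * ((2 * t) C t) * ((2 * (n + l ∸ t)) C (n + l ∸ t)) * ((2 * n) C n) * ((2 * n ∸ 2 * t) C (n ∸ t)))))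
    (((n + l) C n) * ((2 * n + l ∸ t) C n) * (n C t))
    {{denominator≢0 n l t t≤n}}
-- Here m = n - t, a true difference because t ≤ n.
theorem2 n l t t≤n = ≡-/ (numerator n l t) (denominator n l t) {{denominator≢0 n l t t≤n}}
  (cleared-sum n l t (n ∸ t) (m∸n+n≡m t≤n))
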